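{- Let $C(s) = \sum_{n \geq 0} \mathcal{B}_{n,n} s^n$ ($s \in \mathbb{C}$) denote the univariate ordinary generating function of the sequence of central Binomiacci numbers $\langle \mathcal{B}_{n,n} \rangle_{n\ge 0}$. Then $$C(s) = \frac{(s-1)(\sqrt{1-4s}-s)}{(s^2+4s-1)\sqrt{1-4s}}.$$
   Context: $\langle \mathcal{F}_j \rangle_{j\ge 0} = \langle 1,1,2,3,5,8,13,\ldots\rangle$ is the Fibonacci sequence indexed so that $\mathcal{F}_0=\mathcal{F}_1=1$ and $\mathcal{F}_{j+2}=\mathcal{F}_{j+1}+\mathcal{F}_j$. The Binomiacci numbers $\langle \mathcal{B}_{k,n}\rangle_{k,n\ge 0}$ are defined by $\mathcal{B}_{0,n}=\mathcal{F}_n$ for $n\ge 0$, $\mathcal{B}_{k,0}=\mathcal{F}_k$ for $k\ge 0$, and $\mathcal{B}_{k,n}=\mathcal{B}_{k,n-1}+\mathcal{B}_{k-1,n}$ for $k,n\ge 1$. The identity is one of power series at the origin, where $\sqrt{1-4s}$ denotes the branch (power series) with value $1$ at $s=0$. -}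

module Defs where

open import Data.Nat.Base as ℕ using (ℕ; zero; suc; _≤_; _<_; z≤n; s≤s; _∸_)
import Data.Nat.Properties as ℕₚ
open import Data.Fin.Base as Fin using (Fin; toℕ)
import Data.Fin.Properties as Finₚ
import Data.Integer.Base as ℤ
open import Data.Rational.Base
  using (ℚ; 0ℚ; 1ℚ; ½; NonZero; _+_; _-_; _*_; _÷_; 1/_; _/_)
import Data.Rational.Properties as ℚₚ
open import Data.Rational.Solver using (module +-*-Solver)
open import Data.Sum.Base using (inj₁; inj₂)
open import Relation.Binary.PropositionalEquality
open import Algebra.Bundles using (CommutativeRing)
open import Algebra.Properties.Semiring.Sum
  (CommutativeRing.semiring ℚₚ.+-*-commutativeRing) public
  using (sum; sum⁺-syntax; sum-cong-≗; ∑-distrib-+; sum-replicate-zero)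

-- Indexed so that F 0 = F 1 = 1.
F : ℕ → ℕ
F 0             = 1
F 1             = 1
F (suc (suc j)) = F (suc j) ℕ.+ F j

B : ℕ → ℕ → ℕ
B zero    n       = F n
B (suc k) zero    = F (suc k)
B (suc k) (suc n) = B (suc k) n ℕ.+ B k (suc n)

-- Formal power series over ℚ, given by their coefficients; two series are
-- equal when they are pointwise equal (_≗_).
Series : Set
Series = ℕ → ℚ

infixl 6 _+ₛ_ _-ₛ_
infixl 7 _*ₛ_ _/ₛ_
infix  8 _X^_

_X^_ : ℚ → ℕ → Series
(c X^ zero)  zero    = c
(c X^ zero)  (suc n) = 0ℚ
(c X^ suc k) zero    = 0ℚ
(c X^ suc k) (suc n) = (c X^ k) n

fromℕ : ℕ → ℚ
fromℕ n = ℤ.+ n / 1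

const : ℕ → Series
const m = fromℕ m X^ 0

X : Series
X = 1ℚ X^ 1

_+ₛ_ : Series → Series → Series
(f +ₛ g) n = f n + g n

_-ₛ_ : Series → Series → Series
(f -ₛ g) n = f n - g n

_*ₛ_ : Series → Series → Series
(f *ₛ g) n = ∑[ i ≤ n ] (f (toℕ i) * g (n ∸ toℕ i))

-- Long division: subtract (f 0 ÷ g 0) · g from f, cancel one factor X and
-- continue.  See /ₛ-*ₛ.
_/ₛ_ : (f g : Series) → .{{NonZero (g 0)}} → Series
(f /ₛ g) zero    = f 0 ÷ g 0
(f /ₛ g) (suc n) = ((λ m → f (suc m) - (f 0 ÷ g 0) * g (suc m)) /ₛ g) n

-- For f with constant term 1, √-approx f n is the polynomial of degree ≤ n
-- with constant term 1 whose square agrees with f up to and including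
-- degree n.
√-approx : Series → ℕ → Series
√-approx f zero    = const 1
√-approx f (suc n) = p +ₛ (½ * (f (suc n) - (p *ₛ p) (suc n))) X^ (suc n)
  where p = √-approx f n

-- The square root with constant term 1 of a series with constant term 1;
-- meaningless for other series.  See √-square.
√ : Series → Series
√ f n = √-approx f n n

centralGF : Series
centralGF n = fromℕ (B n n)


open ≡-Reasoning
open +-*-Solver using (solve; con; _:=_; _:+_; _:*_; _:-_)

÷-* : ∀ p q .{{_ : NonZero q}} → (p ÷ q) * q ≡ p
÷-* p q = begin
  (p * 1/ q) * q  ≡⟨ ℚₚ.*-assoc p (1/ q) q ⟩
  p * (1/ q * q)  ≡⟨ cong (p *_) (ℚₚ.*-inverseˡ q) ⟩
  p * 1ℚ          ≡⟨ ℚₚ.*-identityʳ p ⟩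
  p               ∎

/ₛ-*ₛ : ∀ f g .{{_ : NonZero (g 0)}} → ((f /ₛ g) *ₛ g) ≗ f
/ₛ-*ₛ f g zero    = trans (ℚₚ.+-identityʳ _) (÷-* (f 0) (g 0))
/ₛ-*ₛ f g (suc n) = trans
  (cong (((f 0 ÷ g 0) * g (suc n)) +_)
        (/ₛ-*ₛ (λ m → f (suc m) - (f 0 ÷ g 0) * g (suc m)) g n))
  (solve 2 (λ a b → a :+ (b :- a) := b) refl ((f 0 ÷ g 0) * g (suc n)) (f (suc n)))

X^-below : ∀ c {j k} → j < k → (c X^ k) j ≡ 0ℚ
X^-below c {zero}  (s≤s _)   = refl
X^-below c {suc j} (s≤s j<k) = X^-below c j<k

X^-at : ∀ c k → (c X^ k) k ≡ c
X^-at c zero    = refl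
X^-at c (suc k) = X^-at c k

X^-*ₛ : ∀ c k h → ((c X^ k) *ₛ h) k ≡ c * h 0
X^-*ₛ c zero    h = ℚₚ.+-identityʳ _
X^-*ₛ c (suc k) h = trans (cong₂ _+_ (ℚₚ.*-zeroˡ (h (suc k))) (X^-*ₛ c k h)) (ℚₚ.+-identityˡ _)

*ₛ-X^ : ∀ c k h → (h *ₛ (c X^ k)) k ≡ h 0 * c
*ₛ-X^ c zero    h = ℚₚ.+-identityʳ _
*ₛ-X^ c (suc k) h = trans
  (cong₂ _+_ (cong (h 0 *_) (X^-at c k)) (trans (sum-cong-≗ vanish) (sum-replicate-zero (suc k))))
  (ℚₚ.+-identityʳ _)
  where
  vanish : ∀ (i : Fin (suc k)) → h (suc (toℕ i)) * (c X^ suc k) (k ∸ toℕ i) ≡ 0ℚ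
  vanish i = trans
    (cong (h (suc (toℕ i)) *_) (X^-below c (s≤s (ℕₚ.m∸n≤m k (toℕ i)))))
    (ℚₚ.*-zeroʳ (h (suc (toℕ i))))

*ₛ-distribʳ : ∀ f g h → ((f +ₛ g) *ₛ h) ≗ ((f *ₛ h) +ₛ (g *ₛ h))
*ₛ-distribʳ f g h n = trans
  (sum-cong-≗ {suc n} (λ i → ℚₚ.*-distribʳ-+ (h (n ∸ toℕ i)) (f (toℕ i)) (g (toℕ i))))
  (∑-distrib-+ {suc n} (λ i → f (toℕ i) * h (n ∸ toℕ i)) (λ i → g (toℕ i) * h (n ∸ toℕ i)))

*ₛ-distribˡ : ∀ f g h → (f *ₛ (g +ₛ h)) ≗ ((f *ₛ g) +ₛ (f *ₛ h))
*ₛ-distribˡ f g h n = trans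
  (sum-cong-≗ {suc n} (λ i → ℚₚ.*-distribˡ-+ (f (toℕ i)) (g (n ∸ toℕ i)) (h (n ∸ toℕ i))))
  (∑-distrib-+ {suc n} (λ i → f (toℕ i) * g (n ∸ toℕ i)) (λ i → f (toℕ i) * h (n ∸ toℕ i)))

*ₛ-cong-≤ : ∀ {f f′ g g′} n → (∀ i → i ≤ n → f i ≡ f′ i) → (∀ i → i ≤ n → g i ≡ g′ i) →
            (f *ₛ g) n ≡ (f′ *ₛ g′) n
*ₛ-cong-≤ n p q = sum-cong-≗ {suc n} λ i →
  cong₂ _*_ (p (toℕ i) (Finₚ.toℕ≤pred[n] i)) (q (n ∸ toℕ i) (ℕₚ.m∸n≤m n (toℕ i)))

√-approx-stable : ∀ f n i → i ≤ n → √-approx f n i ≡ √ f i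
√-approx-stable f zero    zero z≤n = refl
√-approx-stable f (suc n) i i≤1+n with ℕₚ.m≤n⇒m<n∨m≡n i≤1+n
... | inj₂ refl    = refl
... | inj₁ (s≤s i≤n) = trans
  (cong₂ _+_ (√-approx-stable f n i i≤n) (X^-below _ (s≤s i≤n)))
  (ℚₚ.+-identityʳ _)

√-square : ∀ f → f 0 ≡ 1ℚ → (√ f *ₛ √ f) ≗ f
√-square f f0≡1 zero    = sym f0≡1
√-square f f0≡1 (suc n) = begin
  (√ f *ₛ √ f) k
    ≡⟨ *ₛ-cong-≤ k stable stable ⟩
  ((p +ₛ m) *ₛ (p +ₛ m)) k
    ≡⟨ *ₛ-distribʳ p m (p +ₛ m) k ⟩
  (p *ₛ (p +ₛ m)) k + (m *ₛ (p +ₛ m)) k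
    ≡⟨ cong₂ _+_ (trans (*ₛ-distribˡ p p m k) (cong (p² +_) (*ₛ-X^ c k p))) (X^-*ₛ c k (p +ₛ m)) ⟩
  (p² + p 0 * c) + c * (p 0 + 0ℚ)
    ≡⟨ cong (λ x → (p² + x * c) + c * (x + 0ℚ)) (√-approx-stable f n 0 z≤n) ⟩
  (p² + 1ℚ * c) + c * (1ℚ + 0ℚ)
    ≡⟨ solve 2 (λ s a → (s :+ con 1ℚ :* (con ½ :* (a :- s))) :+ (con ½ :* (a :- s)) :* (con 1ℚ :+ con 0ℚ) := a)
         refl p² (f k) ⟩
  f k ∎
  where
  k = suc n
  p = √-approx f n
  p² = (p *ₛ p) k
  c = ½ * (f k - p²)
  m = c X^ k
  stable : ∀ i → i ≤ k → √ f i ≡ (p +ₛ m) i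
  stable i i≤k = sym (√-approx-stable f k i i≤k)

{-# OPTIONS --safe #-}

-- The shifted diagonals D j = Σₙ B n (n + j) Xⁿ satisfy a linear system which
-- determines them coefficientwise.  Let R = √(1 - 4X) and let C = (1 - R)/2X be
-- the Catalan series.  Multiplied by the denominator Q = (X² + 4X - 1) R, the
-- system has the solution X(1 - X)Cʲ - R((1 - 3X)Fⱼ + 2XFⱼ₊₁): the powers of C
-- solve its homogeneous part because C = 1 + XC², and the Fibonacci term is a
-- particular solution.  The case j = 0 is the claim.
module Submission where

open import Algebra.Bundles using (CommutativeRing)
import Algebra.Construct.Pointwise as Pointwise
open import Algebra.Consequences.Setoid using (comm∧idˡ⇒id)
import Algebra.Solver.Ring
open import Algebra.Solver.Ring.AlmostCommutativeRing
  using (_-Raw-AlmostCommutative⟶_; fromCommutativeRing)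
open import Data.Fin.Base using (toℕ)
import Data.Integer.Base as ℤ
import Data.Integer.Properties as ℤₚ
open import Data.Maybe.Base using (map)
open import Data.Nat.Base as ℕ using (ℕ; zero; suc; nonZero; _∸_)
import Data.Nat.Properties as ℕₚ
open import Data.Product.Base using (_,_)
open import Data.Rational.Base
  using (ℚ; 0ℚ; 1ℚ; ½; NonZero; _+_; _-_; _*_; -_; _÷_; 1/_; toℚᵘ)
import Data.Rational.Properties as ℚₚ
import Data.Rational.Solver as ℚ-Solver
open import Data.Rational.Unnormalised.Base as ℚᵘ using (mkℚᵘ; *≡*)
import Data.Rational.Unnormalised.Properties as ℚᵘₚ
open import Level using (0ℓ)
open import Relation.Binary.PropositionalEquality hiding (setoid)
open import Relation.Nullary.Decidable.Core using (dec⇒maybe)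
open import Algebra.Properties.Semiring.Sum
  (CommutativeRing.semiring ℚₚ.+-*-commutativeRing) using (*-distribˡ-sum)
open import Defs

module ℚS = ℚ-Solver.+-*-Solver

fromℕ-+ : ∀ m n → fromℕ (m ℕ.+ n) ≡ fromℕ m + fromℕ n
fromℕ-+ m n = ℚₚ.toℚᵘ-injective (begin
  toℚᵘ (fromℕ (m ℕ.+ n))
    ≈⟨ ℚₚ.toℚᵘ-fromℚᵘ (mkℚᵘ (ℤ.+ (m ℕ.+ n)) 0) ⟩
  mkℚᵘ (ℤ.+ (m ℕ.+ n)) 0
    ≈⟨ *≡* (cong (ℤ._* ℤ.+ 1)
         (sym (cong₂ ℤ._+_ (ℤₚ.*-identityʳ (ℤ.+ m)) (ℤₚ.*-identityʳ (ℤ.+ n))))) ⟩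
  mkℚᵘ (ℤ.+ m) 0 ℚᵘ.+ mkℚᵘ (ℤ.+ n) 0
    ≈⟨ ℚᵘₚ.+-cong (ℚₚ.toℚᵘ-fromℚᵘ (mkℚᵘ (ℤ.+ m) 0)) (ℚₚ.toℚᵘ-fromℚᵘ (mkℚᵘ (ℤ.+ n) 0)) ⟨
  toℚᵘ (fromℕ m) ℚᵘ.+ toℚᵘ (fromℕ n)
    ≈⟨ ℚₚ.toℚᵘ-homo-+ (fromℕ m) (fromℕ n) ⟨
  toℚᵘ (fromℕ m + fromℕ n) ∎)
  where open ℚᵘₚ.≃-Reasoning

-- Cauchy products and division of series.

tail : Series → Series
tail f n = f (suc n)

*ₛ-cong : ∀ {f f′ g g′} → f ≗ f′ → g ≗ g′ → (f *ₛ g) ≗ (f′ *ₛ g′)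
*ₛ-cong p q n = *ₛ-cong-≤ n (λ i _ → p i) (λ i _ → q i)

scale-*ₛ : ∀ a f g → ((λ i → a * f i) *ₛ g) ≗ (λ n → a * (f *ₛ g) n)
scale-*ₛ a f g n = trans
  (sum-cong-≗ {suc n} λ i → ℚₚ.*-assoc a (f (toℕ i)) (g (n ∸ toℕ i)))
  (sym (*-distribˡ-sum {suc n} a (λ i → f (toℕ i) * g (n ∸ toℕ i))))

zero-*ₛ : ∀ f → ((λ _ → 0ℚ) *ₛ f) ≗ (λ _ → 0ℚ)
zero-*ₛ f n = trans (sum-cong-≗ {suc n} λ i → ℚₚ.*-zeroˡ (f (n ∸ toℕ i))) (sum-replicate-zero (suc n))

X^0-*ₛ : ∀ a f → ((a X^ 0) *ₛ f) ≗ (λ n → a * f n)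
X^0-*ₛ a f zero    = ℚₚ.+-identityʳ _
X^0-*ₛ a f (suc n) = trans (cong (a * f (suc n) +_) (zero-*ₛ f n)) (ℚₚ.+-identityʳ _)

X-*ₛ-zero : ∀ f → (X *ₛ f) 0 ≡ 0ℚ
X-*ₛ-zero f = trans (ℚₚ.+-identityʳ _) (ℚₚ.*-zeroˡ (f 0))

X-*ₛ-suc : ∀ f n → (X *ₛ f) (suc n) ≡ f n
X-*ₛ-suc f n = trans
  (cong₂ _+_ (ℚₚ.*-zeroˡ (f (suc n))) (trans (X^0-*ₛ 1ℚ f n) (ℚₚ.*-identityˡ (f n))))
  (ℚₚ.+-identityˡ (f n))

2X-*ₛ-zero : ∀ f → (const 2 *ₛ (X *ₛ f)) 0 ≡ 0ℚ
2X-*ₛ-zero f = trans (X^0-*ₛ (fromℕ 2) (X *ₛ f) 0) (cong (fromℕ 2 *_) (X-*ₛ-zero f))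

2X-*ₛ-suc : ∀ f n → (const 2 *ₛ (X *ₛ f)) (suc n) ≡ fromℕ 2 * f n
2X-*ₛ-suc f n = trans (X^0-*ₛ (fromℕ 2) (X *ₛ f) (suc n)) (cong (fromℕ 2 *_) (X-*ₛ-suc f n))

X-*ₛ-cancel : ∀ {f g} → X *ₛ f ≗ X *ₛ g → f ≗ g
X-*ₛ-cancel {f} {g} p n = trans (sym (X-*ₛ-suc f n)) (trans (p (suc n)) (X-*ₛ-suc g n))

-- The sum unfolds by computation at its first term, which drops the head of `f`; splitting off the
-- last term drops the head of `g`, as the induction for commutativity requires.
*ₛ-suc : ∀ f g n → (f *ₛ g) (suc n) ≡ f (suc n) * g 0 + (f *ₛ tail g) n
*ₛ-suc f g zero    = ℚS.solve 2 (λ x y → x :+ (y :+ con 0ℚ) := y :+ (x :+ con 0ℚ)) refl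
                       (f 0 * g 1) (f 1 * g 0)
  where open ℚS
*ₛ-suc f g (suc n) = trans
  (cong (f 0 * g (suc (suc n)) +_) (*ₛ-suc (tail f) g n))
  (ℚS.solve 3 (λ x y z → x :+ (y :+ z) := y :+ (x :+ z)) refl
    (f 0 * g (suc (suc n))) (f (suc (suc n)) * g 0) ((tail f *ₛ tail g) n))
  where open ℚS

*ₛ-comm : ∀ f g → (f *ₛ g) ≗ (g *ₛ f)
*ₛ-comm f g zero    = cong (_+ 0ℚ) (ℚₚ.*-comm (f 0) (g 0))
*ₛ-comm f g (suc n) = trans
  (cong₂ _+_ (ℚₚ.*-comm (f 0) (g (suc n))) (*ₛ-comm (tail f) g n))
  (sym (*ₛ-suc g f n))

*ₛ-assoc : ∀ f g h → ((f *ₛ g) *ₛ h) ≗ (f *ₛ (g *ₛ h))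
*ₛ-assoc f g h zero    = ℚS.solve 3
  (λ x y z → (x :* y :+ con 0ℚ) :* z :+ con 0ℚ := x :* (y :* z :+ con 0ℚ) :+ con 0ℚ) refl
  (f 0) (g 0) (h 0)
  where open ℚS
*ₛ-assoc f g h (suc n) = trans
  (cong ((f 0 * g 0 + 0ℚ) * h (suc n) +_) (trans
    -- `tail (f *ₛ g)` computes to `tail g` scaled by `f 0`, plus `tail f *ₛ g`; the induction
    -- hypothesis covers the second summand.
    (*ₛ-distribʳ (λ i → f 0 * tail g i) (tail f *ₛ g) h n)
    (cong₂ _+_ (scale-*ₛ (f 0) (tail g) h n) (*ₛ-assoc (tail f) g h n))))
  (ℚS.solve 5
    (λ x y z u v → (x :* y :+ con 0ℚ) :* z :+ (x :* u :+ v) := x :* (y :* z :+ u) :+ v) refl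
    (f 0) (g 0) (h (suc n)) ((tail g *ₛ h) n) ((tail f *ₛ (g *ₛ h)) n))
  where open ℚS

-- Follows the recursion of `_/ₛ_`: the constant terms determine `h 0`, and `tail h *ₛ g` is the
-- remainder on which the division continues.
/ₛ-unique : ∀ h f g .{{_ : NonZero (g 0)}} → h *ₛ g ≗ f → h ≗ f /ₛ g
/ₛ-unique h f g hg≗f = go h f hg≗f
  where
  open ℚS using (_:=_; _:+_; _:-_)

  head-≡ : ∀ h f → h *ₛ g ≗ f → h 0 ≡ f 0 ÷ g 0
  head-≡ h f hg≗f = sym (trans
    (cong (_÷ g 0) (trans (sym (hg≗f 0)) (ℚₚ.+-identityʳ (h 0 * g 0))))
    (trans (ℚₚ.*-assoc (h 0) (g 0) (1/ g 0))
      (trans (cong (h 0 *_) (ℚₚ.*-inverseʳ (g 0))) (ℚₚ.*-identityʳ (h 0)))))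

  go : ∀ h f → h *ₛ g ≗ f → h ≗ f /ₛ g
  go h f hg≗f zero    = head-≡ h f hg≗f
  go h f hg≗f (suc n) = go (tail h) _ (λ m → trans
    (ℚS.solve 2 (λ x y → y := (x :+ y) :- x) refl (h 0 * g (suc m)) ((tail h *ₛ g) m))
    (cong₂ (λ x y → x - y * g (suc m)) (hg≗f (suc m)) (head-≡ h f hg≗f))) n

-- The square root and the Catalan series.

R : Series
R = √ (const 1 -ₛ const 4 *ₛ X)

-- The division of `1 - R` by `X` is an index shift: `1 - R` has constant term 0 and agrees with
-- `- R` elsewhere.
C : Series
C n = - (½ * R (suc n))

R≗1-2XC : R ≗ const 1 -ₛ const 2 *ₛ (X *ₛ C)
R≗1-2XC zero    = sym (cong (λ x → 1ℚ - x) (2X-*ₛ-zero C))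
R≗1-2XC (suc n) = sym (trans
  (cong (λ x → 0ℚ - x) (2X-*ₛ-suc C n))
  (ℚS.solve 1 (λ r → con 0ℚ :- con (fromℕ 2) :* (:- (con ½ :* r)) := r) refl (R (suc n))))
  where open ℚS

-- The ring of series and its solver.

seriesRing : CommutativeRing 0ℓ 0ℓ
seriesRing = record
  { Carrier = Series
  ; _≈_     = _≗_
  ; _+_     = _+ₛ_
  ; _*_     = _*ₛ_
  ; -_      = λ f n → - f n
  ; 0#      = λ _ → 0ℚ
  ; 1#      = const 1
  ; isCommutativeRing = record
    { isRing = record
      { +-isAbelianGroup = Pointwise.isAbelianGroup ℕ ℚₚ.+-0-isAbelianGroup
      ; *-cong           = *ₛ-cong
      ; *-assoc          = *ₛ-assoc
      ; *-identity       = comm∧idˡ⇒id (ℕ →-setoid ℚ) *ₛ-comm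
                             (λ f n → trans (X^0-*ₛ 1ℚ f n) (ℚₚ.*-identityˡ (f n)))
      ; distrib          = *ₛ-distribˡ , (λ h f g → *ₛ-distribʳ f g h)
      }
    ; *-comm = *ₛ-comm
    }
  }

open CommutativeRing seriesRing using (setoid; +-cong; +-congˡ; +-congʳ; *-congˡ; *-congʳ)
  renaming (refl to reflₛ; trans to transₛ)
open import Algebra.Properties.Semiring.Exp (CommutativeRing.semiring seriesRing) using (_^_)
open import Relation.Binary.Reasoning.Setoid setoid

-- Solver coefficients are rationals, whose equality is decidable, embedded as constant series.
X^0-homomorphism : CommutativeRing.rawRing ℚₚ.+-*-commutativeRing
                     -Raw-AlmostCommutative⟶ fromCommutativeRing seriesRing
X^0-homomorphism = record
  { ⟦_⟧    = _X^ 0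
  ; +-homo = λ { a b zero → refl ; a b (suc n) → refl }
  ; *-homo = λ { a b zero → sym (X^0-*ₛ a (b X^ 0) 0)
               ; a b (suc n) → sym (trans (X^0-*ₛ a (b X^ 0) (suc n)) (ℚₚ.*-zeroʳ a)) }
  ; -‿homo = λ { a zero → refl ; a (suc n) → refl }
  ; 0-homo = λ { zero → refl ; (suc n) → refl }
  ; 1-homo = λ _ → refl
  }

module S = Algebra.Solver.Ring _ _ X^0-homomorphism
  (λ a b → map (λ a≡b n → cong (λ x → (x X^ 0) n) a≡b) (dec⇒maybe (a ℚₚ.≟ b)))
open S using (solve; _:=_; _:+_; _:*_; _:-_; Polynomial)

κ : ∀ {n} → ℕ → Polynomial n
κ m = S.con (fromℕ m)

const-+ : ∀ m n → const (m ℕ.+ n) ≗ const m +ₛ const n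
const-+ m n zero    = fromℕ-+ m n
const-+ m n (suc _) = refl

-- This is `R * R = 1 - 4X` with `R = 1 - 2XC`, divided by `4X`.
C-quadratic : C ≗ const 1 +ₛ X *ₛ (C *ₛ C)
C-quadratic = X-*ₛ-cancel (begin
  X *ₛ C
    -- The extra term makes this an identity in arbitrary `X` and `C`; it vanishes because `T`
    -- equals `R`.
    ≈⟨ solve 2 (λ x c → x :* c := x :* (κ 1 :+ x :* (c :* c)) :+
         S.con ¼ :* ((κ 1 :- κ 4 :* x) :- (κ 1 :- κ 2 :* (x :* c)) :* (κ 1 :- κ 2 :* (x :* c))))
         reflₛ X C ⟩
  rhs +ₛ (¼ X^ 0) *ₛ (R² -ₛ T *ₛ T)
    ≈⟨ +-congˡ {rhs} (*-congˡ {¼ X^ 0} λ n → cong (λ z → R² n - z)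
         (trans (sym (*ₛ-cong R≗1-2XC R≗1-2XC n)) (√-square R² refl n))) ⟩
  rhs +ₛ (¼ X^ 0) *ₛ (R² -ₛ R²)
    ≈⟨ solve 2 (λ r s → r :+ S.con ¼ :* (s :- s) := r) reflₛ rhs R² ⟩
  rhs ∎)
  where
  ¼ : ℚ
  ¼ = ½ * ½
  T rhs R² : Series
  T   = const 1 -ₛ const 2 *ₛ (X *ₛ C)
  rhs = X *ₛ (const 1 +ₛ X *ₛ (C *ₛ C))
  R²  = const 1 -ₛ const 4 *ₛ X

-- The linear system and its unique solvability.

record IsSolution (g U : ℕ → Series) : Set where
  field
    base : U 0 ≗ g 0 +ₛ const 2 *ₛ (X *ₛ U 1)
    step : ∀ j → U (suc j) ≗ g (suc j) +ₛ U j +ₛ X *ₛ U (suc (suc j))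

-- The equation for `U j` refers to later unknowns only behind a factor `X`, hence at a smaller
-- coefficient index. The induction is lexicographic: on the coefficient `n` first, then on `j`.
solution-unique : ∀ {g U V} → IsSolution g U → IsSolution g V → ∀ j → U j ≗ V j
solution-unique {g} {U} {V} solU solV j n = agree n j
  where
  open IsSolution solU renaming (base to U₀; step to U₊)
  open IsSolution solV renaming (base to V₀; step to V₊)

  agree   : ∀ n j → U j n ≡ V j n
  agree-X : ∀ n j → (X *ₛ U j) n ≡ (X *ₛ V j) n

  agree n zero    = trans (U₀ n) (trans
    (cong (g 0 n +_) (trans (X^0-*ₛ (fromℕ 2) (X *ₛ U 1) n)
      (trans (cong (fromℕ 2 *_) (agree-X n 1)) (sym (X^0-*ₛ (fromℕ 2) (X *ₛ V 1) n)))))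
    (sym (V₀ n)))
  agree n (suc j) = trans (U₊ j n) (trans
    (cong₂ (λ x y → g (suc j) n + x + y) (agree n j) (agree-X n (suc (suc j))))
    (sym (V₊ j n)))

  agree-X zero    j = trans (X-*ₛ-zero (U j)) (sym (X-*ₛ-zero (V j)))
  agree-X (suc n) j = trans (X-*ₛ-suc (U j) n) (trans (agree n j) (sym (X-*ₛ-suc (V j) n)))

-- By linearity, the denominator can be cleared before two solutions are compared.
*ₛ-solution : ∀ q {g U} → IsSolution g U → IsSolution (λ j → q *ₛ g j) (λ j → q *ₛ U j)
*ₛ-solution q {g} {U} solU = record
  { base = transₛ (*-congˡ {q} base)
      (solve 4 (λ q g x u → q :* (g :+ κ 2 :* (x :* u)) := q :* g :+ κ 2 :* (x :* (q :* u)))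
        reflₛ q (g 0) X (U 1))
  ; step = λ j → transₛ (*-congˡ {q} (step j))
      (solve 5 (λ q g u x v → q :* (g :+ u :+ x :* v) := q :* g :+ q :* u :+ x :* (q :* v))
        reflₛ q (g (suc j)) (U j) X (U (suc (suc j))))
  }
  where open IsSolution solU

-- The shifted diagonals as a solution.

B-sym : ∀ k n → B k n ≡ B n k
B-sym zero    zero    = refl
B-sym zero    (suc n) = refl
B-sym (suc k) zero    = refl
B-sym (suc k) (suc n) = trans
  (cong₂ ℕ._+_ (B-sym (suc k) n) (B-sym k (suc n)))
  (ℕₚ.+-comm (B n (suc k)) (B (suc n) k))

diagonal : ℕ → Series
diagonal j n = fromℕ (B n (n ℕ.+ j))

-- The boundary values `B 0 j = F j` enter here; the recurrence of `B` accounts for all higher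
-- coefficients, so only constant series occur.
source : ℕ → Series
source zero    = const 1
source (suc j) = const (F (suc j)) -ₛ const (F j)

-- Of the two summands of an entry on diagonal `suc j`, one lies on diagonal `j` at the same
-- position, the other on diagonal `suc (suc j)` one position earlier, whence the factor `X`.
diagonal-solution : IsSolution source diagonal
diagonal-solution = record { base = base ; step = step }
  where
  double : ∀ p → p + p ≡ fromℕ 2 * p
  double = ℚS.solve 1 (λ p → p ℚS.:+ p ℚS.:= ℚS.con (fromℕ 2) ℚS.:* p) refl

  base : diagonal 0 ≗ source 0 +ₛ const 2 *ₛ (X *ₛ diagonal 1)
  base zero    = sym (cong (1ℚ +_) (2X-*ₛ-zero (diagonal 1)))
  base (suc n) = trans (cong fromℕ B-eq) (trans
    (trans (fromℕ-+ b b) (double (fromℕ b)))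
    (sym (trans (ℚₚ.+-identityˡ _) (2X-*ₛ-suc (diagonal 1) n))))
    where
    b = B n (n ℕ.+ 1)
    -- The two summands of a central entry are mirror images, which gives the factor 2 in the base
    -- equation.
    B-eq : B (suc n) (suc n ℕ.+ 0) ≡ b ℕ.+ b
    B-eq rewrite ℕₚ.+-identityʳ n | ℕₚ.+-comm n 1 = cong (ℕ._+ B n (suc n)) (B-sym (suc n) n)

  step : ∀ j → diagonal (suc j) ≗ source (suc j) +ₛ diagonal j +ₛ X *ₛ diagonal (suc (suc j))
  step j zero    = sym (trans
    (cong (fromℕ (F (suc j)) - fromℕ (F j) + fromℕ (F j) +_) (X-*ₛ-zero (diagonal (suc (suc j)))))
    (ℚS.solve 2 (λ x y → x ℚS.:- y ℚS.:+ y ℚS.:+ ℚS.con 0ℚ ℚS.:= x) refl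
      (fromℕ (F (suc j))) (fromℕ (F j))))
  step j (suc n) = trans (cong fromℕ B-eq) (trans
    (fromℕ-+ (B (suc n) (suc n ℕ.+ j)) (B n (n ℕ.+ suc (suc j))))
    (cong₂ _+_ (sym (ℚₚ.+-identityˡ (diagonal j (suc n))))
      (sym (X-*ₛ-suc (diagonal (suc (suc j))) n))))
    where
    B-eq : B (suc n) (suc n ℕ.+ suc j) ≡ B (suc n) (suc n ℕ.+ j) ℕ.+ B n (n ℕ.+ suc (suc j))
    B-eq rewrite ℕₚ.+-suc n (suc j) | ℕₚ.+-suc n j = refl

-- The closed form as a solution.

Q : Series
Q = (X *ₛ X +ₛ const 4 *ₛ X -ₛ const 1) *ₛ R

-- The base equation forces the factor `X(1 - X)`: there the Fibonacci part falls short of `Q` by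
-- `X(1 - X)R`, while the powers of `C` contribute `1 - 2XC = R`.
closedForm : ℕ → Series
closedForm j = X *ₛ (const 1 -ₛ X) *ₛ C ^ j
  -ₛ R *ₛ ((const 1 -ₛ const 3 *ₛ X) *ₛ const (F j) +ₛ const 2 *ₛ X *ₛ const (F (suc j)))

closedForm-solution : IsSolution (λ j → Q *ₛ source j) closedForm
closedForm-solution = record { base = base ; step = step }
  where
  base : closedForm 0 ≗ Q *ₛ const 1 +ₛ const 2 *ₛ (X *ₛ closedForm 1)
  base = begin
    closedForm 0
      -- Splitting off a multiple of `(1 - 2XC) - R`, which is zero, leaves an identity in arbitrary
      -- `X`, `C` and `R`.
      ≈⟨ solve 3 (λ x c r → x :* (κ 1 :- x) :* κ 1 :- r :* ((κ 1 :- κ 3 :* x) :* κ 1 :+ κ 2 :* x :* κ 1)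
           := (x :* x :+ κ 4 :* x :- κ 1) :* r :* κ 1
              :+ κ 2 :* (x :* (x :* (κ 1 :- x) :* (c :* κ 1) :- r :* ((κ 1 :- κ 3 :* x) :* κ 1 :+ κ 2 :* x :* κ 2)))
              :+ x :* (κ 1 :- x) :* ((κ 1 :- κ 2 :* (x :* c)) :- r))
           reflₛ X C R ⟩
    rhs +ₛ X *ₛ (const 1 -ₛ X) *ₛ ((const 1 -ₛ const 2 *ₛ (X *ₛ C)) -ₛ R)
      ≈⟨ +-congˡ {rhs} (*-congˡ {X *ₛ (const 1 -ₛ X)} (λ n → cong (λ z → z - R n) (sym (R≗1-2XC n)))) ⟩
    rhs +ₛ X *ₛ (const 1 -ₛ X) *ₛ (R -ₛ R)
      ≈⟨ solve 3 (λ s x r → s :+ x :* (κ 1 :- x) :* (r :- r) := s) reflₛ rhs X R ⟩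
    rhs ∎
    where rhs = Q *ₛ const 1 +ₛ const 2 *ₛ (X *ₛ closedForm 1)

  step : ∀ j → closedForm (suc j) ≗
           Q *ₛ source (suc j) +ₛ closedForm j +ₛ X *ₛ closedForm (suc (suc j))
  step j = begin
    K *ₛ (C *ₛ Cʲ) -ₛ R *ₛ (u *ₛ b +ₛ v *ₛ const (F (suc (suc j))))
      -- After `C = 1 + XC²` and the Fibonacci recurrence are applied, the two powers of `C` and the
      -- two Fibonacci constants can be treated as independent variables.
      ≈⟨ (λ n → cong₂ _-_ (K*-identity n)
           (*-congˡ {R} (+-congˡ {u *ₛ b} (*-congˡ {v} F₂)) n)) ⟩
    K *ₛ (Cʲ +ₛ X *ₛ Cʲ⁺²) -ₛ R *ₛ (u *ₛ b +ₛ v *ₛ (b +ₛ a))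
      ≈⟨ solve 7 (λ x r d e k a b →
           let u = κ 1 :- κ 3 :* x
               v = κ 2 :* x
           in k :* (d :+ x :* e) :- r :* (u :* b :+ v :* (b :+ a))
              := (x :* x :+ κ 4 :* x :- κ 1) :* r :* (b :- a) :+ (k :* d :- r :* (u :* a :+ v :* b))
                 :+ x :* (k :* e :- r :* (u :* (b :+ a) :+ v :* ((b :+ a) :+ b))))
           reflₛ X R Cʲ Cʲ⁺² K a b ⟩
    Q *ₛ source (suc j) +ₛ closedForm j
      +ₛ X *ₛ (K *ₛ Cʲ⁺² -ₛ R *ₛ (u *ₛ (b +ₛ a) +ₛ v *ₛ ((b +ₛ a) +ₛ b)))
      ≈⟨ +-congˡ {Q *ₛ source (suc j) +ₛ closedForm j} (*-congˡ {X} (λ n →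
           cong (λ z → (K *ₛ Cʲ⁺²) n - z) (*-congˡ {R} (+-cong (*-congˡ {u} F₂) (*-congˡ {v} F₃)) n))) ⟨
    Q *ₛ source (suc j) +ₛ closedForm j +ₛ X *ₛ closedForm (suc (suc j)) ∎
    where
    K = X *ₛ (const 1 -ₛ X)
    u = const 1 -ₛ const 3 *ₛ X
    v = const 2 *ₛ X
    Cʲ = C ^ j
    a = const (F j)
    b = const (F (suc j))
    Cʲ⁺² = C *ₛ (C *ₛ Cʲ)
    F₂ : const (F (suc (suc j))) ≗ b +ₛ a
    F₂ = const-+ (F (suc j)) (F j)
    F₃ : const (F (suc (suc (suc j)))) ≗ (b +ₛ a) +ₛ b
    F₃ = transₛ (const-+ (F (suc (suc j))) (F (suc j))) (+-congʳ {b} F₂)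
    K*-identity : K *ₛ (C *ₛ Cʲ) ≗ K *ₛ (Cʲ +ₛ X *ₛ Cʲ⁺²)
    K*-identity = *-congˡ {K} (transₛ (*-congʳ {Cʲ} C-quadratic)
      (solve 3 (λ x c d → (κ 1 :+ x :* (c :* c)) :* d := d :+ x :* (c :* (c :* d))) reflₛ X C Cʲ))

theorem2p2 : centralGF ≗
    ((X -ₛ const 1) *ₛ (√ (const 1 -ₛ const 4 *ₛ X) -ₛ X))
    /ₛ ((X *ₛ X +ₛ const 4 *ₛ X -ₛ const 1) *ₛ √ (const 1 -ₛ const 4 *ₛ X))
theorem2p2 = /ₛ-unique centralGF ((X -ₛ const 1) *ₛ (R -ₛ X)) Q (begin
  centralGF *ₛ Q
    ≈⟨ *-congʳ {Q} (λ n → cong (λ m → fromℕ (B n m)) (sym (ℕₚ.+-identityʳ n))) ⟩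
  diagonal 0 *ₛ Q
    ≈⟨ *ₛ-comm (diagonal 0) Q ⟩
  Q *ₛ diagonal 0
    ≈⟨ solution-unique (*ₛ-solution Q diagonal-solution) closedForm-solution 0 ⟩
  closedForm 0
    -- For `j = 0` the Fibonacci factor collapses to `1 - X`, which then factors out.
    ≈⟨ solve 2 (λ x r → x :* (κ 1 :- x) :* κ 1 :- r :* ((κ 1 :- κ 3 :* x) :* κ 1 :+ κ 2 :* x :* κ 1)
         := (x :- κ 1) :* (r :- x)) reflₛ X R ⟩
  (X -ₛ const 1) *ₛ (R -ₛ X) ∎)
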